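{- For every integer $d\ge 2$ there is a polynomial $p_d$ of degree exactly $d-2$ such that $v_n^d=p_d(n)$ for all integers $n\ge \lceil d/2\rceil+1$.
   Context: The $2\times n$ Miura-ori $M_{2,n}$ ($n\ge1$) has faces $\alpha_{i,j}$ ($i\in\{1,2\}$, $j\in\{1,\dots,n\}$), interior vertices $x_1,\dots,x_{n-1}$, and creases $e_0$ and $e_{3k-1},e_{3k},e_{3k+1}$ ($k=1,\dots,n-1$). At $x_k$ the creases are left $e_{3k-3}$, top $e_{3k-1}$, right $e_{3k}$, bottom $e_{3k+1}$. Face $\alpha_{1,j}$ is bordered by those of $e_{3j-4}$ (iff $j\ge2$), $e_{3j-3}$, $e_{3j-1}$ (iff $j\le n-1$); $\alpha_{2,j}$ by those of $e_{3j-2}$ (iff $j\ge2$), $e_{3j-3}$, $e_{3j+1}$ (iff $j\le n-1$). An MV assignment $\mu$ maps creases to $\{1,-1\}$; it is locally valid if for each $k$ exactly one of $\mu(e_{3k-1}),\mu(e_{3k}),\mu(e_{3k+1})$ differs from $\mu(e_{3k-3})$. The face flip $\mu_\alpha$ negates $\mu$ on the creases bordering $\alpha$; $\alpha$ is flippable under $\mu$ if $\mu,\mu_\alpha$ are both locally valid. $v_n^d$ denotes the number of locally valid MV assignments of $M_{2,n}$ with exactly $d$ flippable faces, i.e., the number of vertices of degree $d$ in the origami flip graph ${\rm OFG}(M_{2,n})$. -}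

module Defs where

open import Data.Bool using (if_then_else_)
open import Data.Fin using (Fin; zero; suc; inject₁)
open import Data.Fin.Properties using (all?) renaming (_≟_ to _≟ᶠ_)
open import Data.Integer using (+_)
open import Data.List using (List; []; _∷_; length; filter; allFin; cartesianProduct; cartesianProductWith)
open import Data.Nat using (ℕ; zero; suc; _<_)
open import Data.Nat.Properties using () renaming (_≟_ to _≟ⁿ_)
open import Data.Product using (_×_; _,_)
open import Data.Rational using (ℚ; 0ℚ; _/_; _+_; _*_)
open import Data.Sign using (Sign; opposite) renaming (+ to ⊕; - to ⊖)
open import Data.Sign.Properties using () renaming (_≟_ to _≟ˢ_)
open import Data.Sum using (_⊎_)
open import Data.Vec using (Vec; []; _∷_; lookup; tabulate)
open import Relation.Binary.PropositionalEquality using (_≡_; _≢_)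
open import Relation.Nullary using (Dec; does; ¬?; _×-dec_; _⊎-dec_)

-- The crease pattern M_{2,n} for n = suc m.  It has m interior vertices, and
-- the 1-based indices j = 1..n (columns) and k = 1..n-1 (vertices) become
-- Fin (suc m) and Fin m.  The vertex x_k lies between columns k and k+1,
-- which are  inject₁ k  and  suc k  as elements of Fin (suc m).

data Crease (m : ℕ) : Set where
  horizontal : Fin (suc m) → Crease m   -- e_{3j-3}, j = 1..n
  top        : Fin m → Crease m         -- e_{3k-1}, k = 1..n-1
  bottom     : Fin m → Crease m         -- e_{3k+1}, k = 1..n-1

-- (zero , j) is α_{1,j} and (suc zero , j) is α_{2,j}.
Face : ℕ → Set
Face m = Fin 2 × Fin (suc m)

faces : ∀ m → List (Face m)
faces m = cartesianProduct (allFin 2) (allFin (suc m))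

Borders : ∀ {m} → Crease m → Face m → Set
Borders (horizontal j′) (i , j) = j ≡ j′
Borders (top k)         (i , j) = i ≡ zero × (j ≡ inject₁ k ⊎ j ≡ suc k)
Borders (bottom k)      (i , j) = i ≡ suc zero × (j ≡ inject₁ k ⊎ j ≡ suc k)

borders? : ∀ {m} (c : Crease m) (α : Face m) → Dec (Borders c α)
borders? (horizontal j′) (i , j) = j ≟ᶠ j′
borders? (top k)         (i , j) = (i ≟ᶠ zero) ×-dec ((j ≟ᶠ inject₁ k) ⊎-dec (j ≟ᶠ suc k))
borders? (bottom k)      (i , j) = (i ≟ᶠ suc zero) ×-dec ((j ≟ᶠ inject₁ k) ⊎-dec (j ≟ᶠ suc k))

-- A function Crease m → Sign, stored as vectors so that equal assignments are
-- propositionally equal and all assignments can be listed without repetition.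
record MV (m : ℕ) : Set where
  constructor mv
  field
    horizontals : Vec Sign (suc m)
    tops        : Vec Sign m
    bottoms     : Vec Sign m

open MV public

infix 9 _at_

_at_ : ∀ {m} → MV m → Crease m → Sign
μ at horizontal j = lookup (horizontals μ) j
μ at top k        = lookup (tops μ) k
μ at bottom k     = lookup (bottoms μ) k

fromFunction : ∀ {m} → (Crease m → Sign) → MV m
fromFunction f = mv (tabulate (λ j → f (horizontal j))) (tabulate (λ k → f (top k))) (tabulate (λ k → f (bottom k)))

signVectors : ∀ m → List (Vec Sign m)
signVectors zero    = [] ∷ []
signVectors (suc m) = cartesianProductWith _∷_ (⊕ ∷ ⊖ ∷ []) (signVectors m)

assignments : ∀ m → List (MV m)
assignments m =
  cartesianProductWith (λ h (t , b) → mv h t b)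
    (signVectors (suc m)) (cartesianProduct (signVectors m) (signVectors m))

leftCrease rightCrease : ∀ {m} → Fin m → Crease m
leftCrease  k = horizontal (inject₁ k)
rightCrease k = horizontal (suc k)

differing : ∀ {m} → MV m → Fin m → ℕ
differing μ k =
  length (filter (λ s → ¬? (s ≟ˢ μ at leftCrease k))
                 (μ at top k ∷ μ at rightCrease k ∷ μ at bottom k ∷ []))

LocallyValid : ∀ {m} → MV m → Set
LocallyValid μ = ∀ k → differing μ k ≡ 1

locallyValid? : ∀ {m} (μ : MV m) → Dec (LocallyValid μ)
locallyValid? μ = all? (λ k → differing μ k ≟ⁿ 1)

faceFlip : ∀ {m} → MV m → Face m → MV m
faceFlip μ α = fromFunction (λ c → if does (borders? c α) then opposite (μ at c) else μ at c)

Flippable : ∀ {m} → MV m → Face m → Set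
Flippable μ α = LocallyValid μ × LocallyValid (faceFlip μ α)

flippable? : ∀ {m} (μ : MV m) (α : Face m) → Dec (Flippable μ α)
flippable? μ α = locallyValid? μ ×-dec locallyValid? (faceFlip μ α)

flippableFaces : ∀ {m} → MV m → ℕ
flippableFaces {m} μ = length (filter (flippable? μ) (faces m))

-- v n d is v_n^d; M_{2,n} exists only for n ≥ 1, so v zero d is a dummy value.
v : ℕ → ℕ → ℕ
v zero    d = 0
v (suc m) d =
  length (filter (λ μ → locallyValid? μ ×-dec (flippableFaces μ ≟ⁿ d)) (assignments m))

-- Coefficient lists, constant term first; trailing zeros are allowed.
-- Rational coefficients lose nothing: a real or complex polynomial with integer
-- values at infinitely many integers has rational coefficients.
Polynomial : Set
Polynomial = List ℚ

coeff : Polynomial → ℕ → ℚ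
coeff []      i       = 0ℚ
coeff (a ∷ p) zero    = a
coeff (a ∷ p) (suc i) = coeff p i

HasDegree : Polynomial → ℕ → Set
HasDegree p k = coeff p k ≢ 0ℚ × (∀ i → k < i → coeff p i ≡ 0ℚ)

eval : Polynomial → ℚ → ℚ
eval []      x = 0ℚ
eval (a ∷ p) x = a + x * eval p x

fromℕ : ℕ → ℚ
fromℕ n = + n / 1

{-# OPTIONS --safe #-}

-- A locally valid assignment is the sign of e₀ together with a word over {T, R, B}:
-- the k-th letter names the crease at x_k whose sign differs from the left one.  The
-- faces α_{1,j} and α_{2,j} are flippable according to the letters at x_{j-1} and x_j
-- alone: a column between letters a and c has 2 flippable faces if a = c = R, none if
-- a = c ∈ {T, B}, and 1 otherwise, where the two ends of the word count as R.
-- Identifying T with B gives a 2×2 transfer matrix, and its characteristic equation is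
--   v_{n+1}^d − v_n^d = v_n^{d−1} + v_n^{d−2} + v_{n−1}^{d−2} − v_{n−1}^{d−3}.
-- By induction on d, the (d−2)-nd difference of n ↦ v_n^d is constantly 4 from
-- n = ⌈d/2⌉ + 1 on, so v_n^d agrees there with a polynomial in n with leading
-- coefficient 4 / (d−2)!, found by expanding in falling factorials.

module Submission where

open import Defs
open import Data.Nat using (ℕ; zero; suc; pred; _∸_; _≤_; _<_; _≤′_; ≤′-refl; ≤′-step; s≤s; ⌈_/2⌉)
open import Data.Product using (∃-syntax; _×_; _,_)
open import Function using (_∘_; id)
open import Relation.Binary.PropositionalEquality using (_≡_; _≢_; refl; sym; trans; cong; cong₂; subst; module ≡-Reasoning)

module Counting where

  open import Data.Bool using (Bool; true; false; _∧_; if_then_else_)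
  open import Data.Bool.Properties using (∧-identityʳ)
  open import Data.Fin using (Fin; zero; suc)
  open import Data.List using (List; []; _∷_; _++_; length; filter; map; cartesianProduct; cartesianProductWith) renaming (tabulate to tabulateᴸ)
  open import Data.List.Properties using (map-cong; map-++; map-∘)
  open import Data.Maybe using (Maybe; just; nothing; maybe; is-just)
  open import Data.Nat using (_+_; _*_)
  open import Data.Nat.ListAction using (sum)
  open import Data.Nat.ListAction.Properties using (sum-++)
  open import Data.Nat.Properties using (+-identityʳ; *-distribˡ-+) renaming (_≟_ to _≟ⁿ_)
  open import Data.Nat.Solver using (module +-*-Solver)
  open import Data.Sign using (Sign; opposite) renaming (+ to ⊕; - to ⊖; _*_ to _·_)
  open import Data.Sign.Properties using () renaming (_≟_ to _≟ˢ_)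
  open import Data.Vec using (Vec; []; _∷_; head)
  open import Data.Vec.Properties using (tabulate∘lookup)
  open import Relation.Nullary using (does; ¬?)
  open import Relation.Unary using (Decidable)

  open +-*-Solver using (solve; _:+_; _:*_; _:=_; con)

  -- Finite sums and Boolean counts.

  indicator : Bool → ℕ
  indicator b = if b then 1 else 0

  ∑ : {A : Set} → List A → (A → ℕ) → ℕ
  ∑ xs f = sum (map f xs)

  ∑-cong : {A : Set} (xs : List A) {f g : A → ℕ} → (∀ x → f x ≡ g x) → ∑ xs f ≡ ∑ xs g
  ∑-cong xs f≗g = cong sum (map-cong f≗g xs)

  ∑-+ : {A : Set} (xs : List A) (f g : A → ℕ) → ∑ xs (λ x → f x + g x) ≡ ∑ xs f + ∑ xs g
  ∑-+ []       f g = refl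
  ∑-+ (x ∷ xs) f g rewrite ∑-+ xs f g =
    solve 4 (λ a b c d → a :+ b :+ (c :+ d) := a :+ c :+ (b :+ d)) refl (f x) (g x) (∑ xs f) (∑ xs g)

  ∑-zero : {A : Set} (xs : List A) → ∑ xs (λ _ → 0) ≡ 0
  ∑-zero []       = refl
  ∑-zero (x ∷ xs) = ∑-zero xs

  ∑-cartesianProductWith : {A B C : Set} (f : A → B → C) (xs : List A) (ys : List B) (F : C → ℕ) →
    ∑ (cartesianProductWith f xs ys) F ≡ ∑ xs (λ x → ∑ ys (λ y → F (f x y)))
  ∑-cartesianProductWith f []       ys F = refl
  ∑-cartesianProductWith f (x ∷ xs) ys F = begin
    sum (map F (map (f x) ys ++ zs))                    ≡⟨ cong sum (map-++ F (map (f x) ys) zs) ⟩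
    sum (map F (map (f x) ys) ++ map F zs)              ≡⟨ sum-++ (map F (map (f x) ys)) (map F zs) ⟩
    sum (map F (map (f x) ys)) + sum (map F zs)         ≡⟨ cong₂ _+_ (cong sum (sym (map-∘ ys))) (∑-cartesianProductWith f xs ys F) ⟩
    ∑ ys (F ∘ f x) + ∑ xs (λ x′ → ∑ ys (λ y → F (f x′ y))) ∎
    where
    open ≡-Reasoning
    zs = cartesianProductWith f xs ys

  length-filter-∑ : {A : Set} {P : A → Set} (P? : Decidable P) (xs : List A) →
    length (filter P? xs) ≡ ∑ xs (λ x → indicator (does (P? x)))
  length-filter-∑ P? []       = refl
  length-filter-∑ P? (x ∷ xs) with does (P? x)
  ... | true  = cong suc (length-filter-∑ P? xs)
  ... | false = length-filter-∑ P? xs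

  count : ∀ {n} → (Fin n → Bool) → ℕ
  count {zero}  p = 0
  count {suc n} p = indicator (p zero) + count (p ∘ suc)

  count-cong : ∀ {n} {p q : Fin n → Bool} → (∀ j → p j ≡ q j) → count p ≡ count q
  count-cong {zero}  p≗q = refl
  count-cong {suc n} p≗q = cong₂ _+_ (cong indicator (p≗q zero)) (count-cong (p≗q ∘ suc))

  ∑-tabulate : ∀ {n} {A : Set} (f : Fin n → A) (p : A → Bool) → ∑ (tabulateᴸ f) (indicator ∘ p) ≡ count (p ∘ f)
  ∑-tabulate {zero}  f p = refl
  ∑-tabulate {suc n} f p = cong (indicator (p (f zero)) +_) (∑-tabulate (f ∘ suc) p)

  -- Vertex types

  -- The crease at a vertex (top, right or bottom) whose sign differs from the left one.
  data VertexType : Set where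
    T R B : VertexType

  -- Multiplying by the left sign turns "differs from the left crease" into `⊖`, so both left signs
  -- share one case analysis. The value `nothing` marks a vertex that is not locally valid.
  vertexType : (left top right bottom : Sign) → Maybe VertexType
  vertexType l t r b = classify (l · t) (l · r) (l · b)
    where
    classify : Sign → Sign → Sign → Maybe VertexType
    classify ⊖ ⊕ ⊕ = just T
    classify ⊕ ⊖ ⊕ = just R
    classify ⊕ ⊕ ⊖ = just B
    classify _ _ _ = nothing

  validVertex : (left top right bottom : Sign) → Bool
  validVertex l t r b = does (length (filter (λ s → ¬? (s ≟ˢ l)) (t ∷ r ∷ b ∷ [])) ≟ⁿ 1)

  -- Whether a vertex of the given type stays valid when the face to its right
  -- (resp. left) in row i is flipped.
  rightFlip leftFlip : VertexType → Fin 2 → Bool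
  rightFlip T zero       = true
  rightFlip T (suc zero) = false
  rightFlip R i          = true
  rightFlip B zero       = false
  rightFlip B (suc zero) = true
  leftFlip T zero       = false
  leftFlip T (suc zero) = true
  leftFlip R i          = true
  leftFlip B zero       = true
  leftFlip B (suc zero) = false

  flipTop flipBottom : Fin 2 → Sign → Sign
  flipTop zero    s = opposite s
  flipTop (suc _) s = s
  flipBottom zero    s = s
  flipBottom (suc _) s = opposite s

  validVertex-vertexType : ∀ l t r b → validVertex l t r b ≡ is-just (vertexType l t r b)
  validVertex-vertexType ⊕ ⊕ ⊕ ⊕ = refl
  validVertex-vertexType ⊕ ⊕ ⊕ ⊖ = refl
  validVertex-vertexType ⊕ ⊕ ⊖ ⊕ = refl
  validVertex-vertexType ⊕ ⊕ ⊖ ⊖ = refl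
  validVertex-vertexType ⊕ ⊖ ⊕ ⊕ = refl
  validVertex-vertexType ⊕ ⊖ ⊕ ⊖ = refl
  validVertex-vertexType ⊕ ⊖ ⊖ ⊕ = refl
  validVertex-vertexType ⊕ ⊖ ⊖ ⊖ = refl
  validVertex-vertexType ⊖ ⊕ ⊕ ⊕ = refl
  validVertex-vertexType ⊖ ⊕ ⊕ ⊖ = refl
  validVertex-vertexType ⊖ ⊕ ⊖ ⊕ = refl
  validVertex-vertexType ⊖ ⊕ ⊖ ⊖ = refl
  validVertex-vertexType ⊖ ⊖ ⊕ ⊕ = refl
  validVertex-vertexType ⊖ ⊖ ⊕ ⊖ = refl
  validVertex-vertexType ⊖ ⊖ ⊖ ⊕ = refl
  validVertex-vertexType ⊖ ⊖ ⊖ ⊖ = refl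

  -- The flip negates the right crease and one of top and bottom, so the number of differences stays
  -- 1 exactly when the odd crease is one of these two. In each row six sign patterns have a type;
  -- the hypothesis rules out the other ten.
  validVertex-rightFlip : ∀ i l t r b {c} → vertexType l t r b ≡ just c →
    validVertex l (flipTop i t) (opposite r) (flipBottom i b) ≡ rightFlip c i
  validVertex-rightFlip zero       ⊕ ⊖ ⊕ ⊕ refl = refl
  validVertex-rightFlip zero       ⊕ ⊕ ⊖ ⊕ refl = refl
  validVertex-rightFlip zero       ⊕ ⊕ ⊕ ⊖ refl = refl
  validVertex-rightFlip zero       ⊖ ⊕ ⊖ ⊖ refl = refl
  validVertex-rightFlip zero       ⊖ ⊖ ⊕ ⊖ refl = refl
  validVertex-rightFlip zero       ⊖ ⊖ ⊖ ⊕ refl = refl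
  validVertex-rightFlip (suc zero) ⊕ ⊖ ⊕ ⊕ refl = refl
  validVertex-rightFlip (suc zero) ⊕ ⊕ ⊖ ⊕ refl = refl
  validVertex-rightFlip (suc zero) ⊕ ⊕ ⊕ ⊖ refl = refl
  validVertex-rightFlip (suc zero) ⊖ ⊕ ⊖ ⊖ refl = refl
  validVertex-rightFlip (suc zero) ⊖ ⊖ ⊕ ⊖ refl = refl
  validVertex-rightFlip (suc zero) ⊖ ⊖ ⊖ ⊕ refl = refl

  -- Negating the left crease reverses all three comparisons, and negating top or bottom restores
  -- that one. The count stays 1 exactly when the odd crease is one of the other two.
  validVertex-leftFlip : ∀ i l t r b {c} → vertexType l t r b ≡ just c →
    validVertex (opposite l) (flipTop i t) r (flipBottom i b) ≡ leftFlip c i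
  validVertex-leftFlip zero       ⊕ ⊖ ⊕ ⊕ refl = refl
  validVertex-leftFlip zero       ⊕ ⊕ ⊖ ⊕ refl = refl
  validVertex-leftFlip zero       ⊕ ⊕ ⊕ ⊖ refl = refl
  validVertex-leftFlip zero       ⊖ ⊕ ⊖ ⊖ refl = refl
  validVertex-leftFlip zero       ⊖ ⊖ ⊕ ⊖ refl = refl
  validVertex-leftFlip zero       ⊖ ⊖ ⊖ ⊕ refl = refl
  validVertex-leftFlip (suc zero) ⊕ ⊖ ⊕ ⊕ refl = refl
  validVertex-leftFlip (suc zero) ⊕ ⊕ ⊖ ⊕ refl = refl
  validVertex-leftFlip (suc zero) ⊕ ⊕ ⊕ ⊖ refl = refl
  validVertex-leftFlip (suc zero) ⊖ ⊕ ⊖ ⊖ refl = refl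
  validVertex-leftFlip (suc zero) ⊖ ⊖ ⊕ ⊖ refl = refl
  validVertex-leftFlip (suc zero) ⊖ ⊖ ⊖ ⊕ refl = refl

  -- Local validity after prepending a vertex or flipping a face.

  valid : ∀ {m} → MV m → Bool
  valid μ = does (locallyValid? μ)

  extend : ∀ {m} → (left top bottom : Sign) → MV m → MV (suc m)
  extend l t b (mv hs ts bs) = mv (l ∷ hs) (t ∷ ts) (b ∷ bs)

  firstHorizontal : ∀ {m} → MV m → Sign
  firstHorizontal μ = head (horizontals μ)

  valid-extend : ∀ {m} l t b (μ : MV m) →
    valid (extend l t b μ) ≡ validVertex l t (firstHorizontal μ) b ∧ valid μ
  valid-extend l t b (mv (r ∷ hs) ts bs) = refl

  valid-flip-column₀ : ∀ {m} i l t b (μ : MV m) →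
    valid (faceFlip (extend l t b μ) (i , zero)) ≡
    validVertex (opposite l) (flipTop i t) (firstHorizontal μ) (flipBottom i b) ∧ valid μ
  valid-flip-column₀ zero l t b (mv (r ∷ hs) ts bs)
    -- `faceFlip` rebuilds all vectors by `tabulate`; past the first vertex the flip changes
    -- nothing, and `tabulate∘lookup` gives back the entries of `μ`.
    rewrite tabulate∘lookup hs | tabulate∘lookup ts | tabulate∘lookup bs = refl
  valid-flip-column₀ (suc zero) l t b (mv (r ∷ hs) ts bs)
    rewrite tabulate∘lookup hs | tabulate∘lookup ts | tabulate∘lookup bs = refl

  -- The second column lies to the right of the new vertex and is at the same time the first column
  -- of `μ`, so both conjuncts change.
  valid-flip-column₁ : ∀ {m} i l t b (μ : MV m) →
    valid (faceFlip (extend l t b μ) (i , suc zero)) ≡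
    validVertex l (flipTop i t) (opposite (firstHorizontal μ)) (flipBottom i b) ∧ valid (faceFlip μ (i , zero))
  valid-flip-column₁ zero       l t b (mv (r ∷ hs) ts bs) = refl
  valid-flip-column₁ (suc zero) l t b (mv (r ∷ hs) ts bs) = refl

  valid-flip-column₂₊ : ∀ {m} i l t b (μ : MV m) j →
    valid (faceFlip (extend l t b μ) (i , suc (suc j))) ≡
    validVertex l t (firstHorizontal μ) b ∧ valid (faceFlip μ (i , suc j))
  valid-flip-column₂₊ zero       l t b (mv (r ∷ hs) ts bs) j = refl
  valid-flip-column₂₊ (suc zero) l t b (mv (r ∷ hs) ts bs) j = refl

  -- The number of faces in row i that can be flipped when the pattern is continued
  -- to the left by a vertex of type a.
  rowDegree : ∀ {m} → Fin 2 → VertexType → MV m → ℕ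
  rowDegree i a μ =
    indicator (rightFlip a i ∧ valid (faceFlip μ (i , zero))) + count (λ j → valid (faceFlip μ (i , suc j)))

  -- The new first column lies between `a` and `c` and gives the indicator. The old first column now
  -- lies to the right of `c`, and later columns do not meet the new vertex; together they give
  -- `rowDegree i c μ`.
  rowDegree-extend : ∀ {m} i a c l t b (μ : MV m) →
    vertexType l t (firstHorizontal μ) b ≡ just c → valid μ ≡ true →
    rowDegree i a (extend l t b μ) ≡ indicator (rightFlip a i ∧ leftFlip c i) + rowDegree i c μ
  rowDegree-extend i a c l t b μ eq valid-μ = cong₂ _+_
    (cong (λ p → indicator (rightFlip a i ∧ p)) column₀)
    (cong₂ _+_ (cong indicator column₁) (count-cong column₂₊))
    where
    r = firstHorizontal μ

    column₀ : valid (faceFlip (extend l t b μ) (i , zero)) ≡ leftFlip c i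
    column₀ rewrite valid-flip-column₀ i l t b μ | valid-μ | validVertex-leftFlip i l t r b eq =
      ∧-identityʳ (leftFlip c i)

    column₁ : valid (faceFlip (extend l t b μ) (i , suc zero)) ≡ rightFlip c i ∧ valid (faceFlip μ (i , zero))
    column₁ rewrite valid-flip-column₁ i l t b μ | validVertex-rightFlip i l t r b eq = refl

    column₂₊ : ∀ j → valid (faceFlip (extend l t b μ) (i , suc (suc j))) ≡ valid (faceFlip μ (i , suc j))
    column₂₊ j rewrite valid-flip-column₂₊ i l t b μ j | validVertex-vertexType l t r b | eq = refl

  degree : ∀ {m} → VertexType → MV m → ℕ
  degree a μ = rowDegree zero a μ + rowDegree (suc zero) a μ

  -- The exponent of `y` in the transfer-matrix entry from `a` to `c`.
  weight : VertexType → VertexType → ℕ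
  weight a c = indicator (rightFlip a zero ∧ leftFlip c zero) + indicator (rightFlip a (suc zero) ∧ leftFlip c (suc zero))

  degree-extend : ∀ {m} a c l t b (μ : MV m) →
    vertexType l t (firstHorizontal μ) b ≡ just c → valid μ ≡ true →
    degree a (extend l t b μ) ≡ weight a c + degree c μ
  degree-extend a c l t b μ eq valid-μ
    rewrite rowDegree-extend zero a c l t b μ eq valid-μ | rowDegree-extend (suc zero) a c l t b μ eq valid-μ =
    solve 4 (λ x y z w → x :+ y :+ (z :+ w) := x :+ z :+ (y :+ w)) refl
      (indicator (rightFlip a zero ∧ leftFlip c zero)) (rowDegree zero c μ)
      (indicator (rightFlip a (suc zero) ∧ leftFlip c (suc zero))) (rowDegree (suc zero) c μ)

  -- A boundary column behaves as if there were a vertex of type R beyond it.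
  flippableFaces-degree : ∀ {m} (μ : MV m) → valid μ ≡ true → flippableFaces μ ≡ degree R μ
  flippableFaces-degree {m} μ valid-μ = begin
    length (filter (flippable? μ) (faces m))   ≡⟨ length-filter-∑ (flippable? μ) (faces m) ⟩
    ∑ (faces m) (indicator ∘ p)               ≡⟨ ∑-cartesianProductWith _,_ (tabulateᴸ id) (tabulateᴸ id) (indicator ∘ p) ⟩
    row zero + (row (suc zero) + 0)            ≡⟨ cong₂ _+_ (row-degree zero) (trans (+-identityʳ _) (row-degree (suc zero))) ⟩
    degree R μ                                 ∎
    where
    open ≡-Reasoning
    p : Face m → Bool
    p α = valid μ ∧ valid (faceFlip μ α)

    row : Fin 2 → ℕ
    row i = ∑ (tabulateᴸ id) (λ j → indicator (p (i , j)))

    row-degree : ∀ i → row i ≡ rowDegree i R μ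
    row-degree i = trans (∑-tabulate id (λ j → p (i , j)))
      (count-cong (λ j → cong (_∧ valid (faceFlip μ (i , j))) valid-μ))

  -- Summation over locally valid assignments

  -- The function `φ` is general, not just a test for degree `d`: removing the first vertex lowers
  -- the degree by a weight, and composing `φ` with that shift keeps the induction closed.
  validTerm : ∀ {m} → (ℕ → ℕ) → VertexType → MV m → ℕ
  validTerm φ a μ = if valid μ then φ (degree a μ) else 0

  validTerm-extend : ∀ {m} φ a l t b (μ : MV m) →
    validTerm φ a (extend l t b μ) ≡
    maybe (λ c → validTerm (φ ∘ (weight a c +_)) c μ) 0 (vertexType l t (firstHorizontal μ) b)
  validTerm-extend φ a l t b μ
    rewrite valid-extend l t b μ | validVertex-vertexType l t (firstHorizontal μ) b
    with vertexType l t (firstHorizontal μ) b in eq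
  ... | nothing = refl
  ... | just c with valid μ in valid-μ
  ...   | false = refl
  ...   | true  = cong φ (degree-extend a c l t b μ eq valid-μ)

  ∑³ : ∀ m → (Vec Sign m → Vec Sign m → Vec Sign m → ℕ) → ℕ
  ∑³ m F = ∑ (signVectors m) λ hs → ∑ (signVectors m) λ ts → ∑ (signVectors m) λ bs → F hs ts bs

  ∑³-cong : ∀ m {F G : Vec Sign m → Vec Sign m → Vec Sign m → ℕ} →
    (∀ hs ts bs → F hs ts bs ≡ G hs ts bs) → ∑³ m F ≡ ∑³ m G
  ∑³-cong m F≗G = ∑-cong (signVectors m) λ hs → ∑-cong (signVectors m) λ ts → ∑-cong (signVectors m) λ bs → F≗G hs ts bs

  ∑³-zero : ∀ m → ∑³ m (λ _ _ _ → 0) ≡ 0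
  ∑³-zero m = trans
    (∑-cong (signVectors m) λ _ → trans (∑-cong (signVectors m) λ _ → ∑-zero (signVectors m)) (∑-zero (signVectors m)))
    (∑-zero (signVectors m))

  ∑± : (Sign → ℕ) → ℕ
  ∑± f = f ⊕ + f ⊖

  ∑±-cong : {f g : Sign → ℕ} → (∀ s → f s ≡ g s) → ∑± f ≡ ∑± g
  ∑±-cong f≗g = cong₂ _+_ (f≗g ⊕) (f≗g ⊖)

  ∑-signVectors-suc : ∀ m (F : Vec Sign (suc m) → ℕ) →
    ∑ (signVectors (suc m)) F ≡ ∑± λ s → ∑ (signVectors m) λ ss → F (s ∷ ss)
  ∑-signVectors-suc m F = trans (∑-cartesianProductWith _∷_ (⊕ ∷ ⊖ ∷ []) (signVectors m) F)
    (cong (∑ (signVectors m) (F ∘ (⊕ ∷_)) +_) (+-identityʳ _))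

  ∑-∑± : {A : Set} (xs : List A) (F : Sign → A → ℕ) →
    ∑ xs (λ x → ∑± λ s → F s x) ≡ ∑± λ s → ∑ xs (F s)
  ∑-∑± xs F = ∑-+ xs (F ⊕) (F ⊖)

  ∑³-suc : ∀ m (F : Vec Sign (suc m) → Vec Sign (suc m) → Vec Sign (suc m) → ℕ) →
    ∑³ (suc m) F ≡ ∑± λ r → ∑± λ t → ∑± λ b → ∑³ m λ hs ts bs → F (r ∷ hs) (t ∷ ts) (b ∷ bs)
  ∑³-suc m F = begin
    ∑³ (suc m) F
      ≡⟨ ∑-signVectors-suc m (λ hs → ∑ V′ λ ts → ∑ V′ λ bs → F hs ts bs) ⟩
    (∑± λ r → ∑ V λ hs → ∑ V′ λ ts → ∑ V′ λ bs → F (r ∷ hs) ts bs)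
      ≡⟨ (∑±-cong λ r → ∑-cong V λ hs → ∑-signVectors-suc m λ ts → ∑ V′ λ bs → F (r ∷ hs) ts bs) ⟩
    (∑± λ r → ∑ V λ hs → ∑± λ t → ∑ V λ ts → ∑ V′ λ bs → F (r ∷ hs) (t ∷ ts) bs)
      ≡⟨ (∑±-cong λ r → ∑-∑± V λ t hs → ∑ V λ ts → ∑ V′ λ bs → F (r ∷ hs) (t ∷ ts) bs) ⟩
    (∑± λ r → ∑± λ t → ∑ V λ hs → ∑ V λ ts → ∑ V′ λ bs → F (r ∷ hs) (t ∷ ts) bs)
      ≡⟨ (∑±-cong λ r → ∑±-cong λ t → ∑-cong V λ hs → ∑-cong V λ ts → ∑-signVectors-suc m λ bs → F (r ∷ hs) (t ∷ ts) bs) ⟩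
    (∑± λ r → ∑± λ t → ∑ V λ hs → ∑ V λ ts → ∑± λ b → ∑ V λ bs → F (r ∷ hs) (t ∷ ts) (b ∷ bs))
      ≡⟨ (∑±-cong λ r → ∑±-cong λ t → ∑-cong V λ hs → ∑-∑± V λ b ts → ∑ V λ bs → F (r ∷ hs) (t ∷ ts) (b ∷ bs)) ⟩
    (∑± λ r → ∑± λ t → ∑ V λ hs → ∑± λ b → ∑ V λ ts → ∑ V λ bs → F (r ∷ hs) (t ∷ ts) (b ∷ bs))
      ≡⟨ (∑±-cong λ r → ∑±-cong λ t → ∑-∑± V λ b hs → ∑ V λ ts → ∑ V λ bs → F (r ∷ hs) (t ∷ ts) (b ∷ bs)) ⟩
    (∑± λ r → ∑± λ t → ∑± λ b → ∑³ m λ hs ts bs → F (r ∷ hs) (t ∷ ts) (b ∷ bs)) ∎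
    where
    open ≡-Reasoning
    V  = signVectors m
    V′ = signVectors (suc m)

  -- The transfer-matrix recursion over the `m` letters after `a`. Weights already met are absorbed
  -- into `φ`; the last column is closed by `R`, the right end.
  wordSum : (ℕ → ℕ) → VertexType → ℕ → ℕ
  wordSum φ a zero    = φ (weight a R)
  wordSum φ a (suc m) = step T + step R + step B
    where
    step : VertexType → ℕ
    step c = wordSum (φ ∘ (weight a c +_)) c m

  validSum : (ℕ → ℕ) → VertexType → Sign → ℕ → ℕ
  validSum φ a l m = ∑³ m λ hs ts bs → validTerm φ a (mv (l ∷ hs) ts bs)

  validSum≡wordSum : ∀ m φ a l → validSum φ a l m ≡ wordSum φ a m
  -- Each of the three sums has a single term and leaves a `+ 0`. Matching on the letter lets the
  -- degree and `weight a R` compute to the same number.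
  validSum≡wordSum zero φ T l = trans (+-identityʳ _) (trans (+-identityʳ _) (+-identityʳ _))
  validSum≡wordSum zero φ R l = trans (+-identityʳ _) (trans (+-identityʳ _) (+-identityʳ _))
  validSum≡wordSum zero φ B l = trans (+-identityʳ _) (trans (+-identityʳ _) (+-identityʳ _))
  validSum≡wordSum (suc m) φ a l = begin
    validSum φ a l (suc m)
      ≡⟨ ∑³-suc m _ ⟩
    (∑± λ r → ∑± λ t → ∑± λ b → ∑³ m λ hs ts bs → validTerm φ a (extend l t b (mv (r ∷ hs) ts bs)))
      ≡⟨ (∑±-cong λ r → ∑±-cong λ t → ∑±-cong λ b → byType r t b) ⟩
    (∑± λ r → ∑± λ t → ∑± λ b → maybe step 0 (vertexType l t r b))
      ≡⟨ collect l ⟩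
    wordSum φ a (suc m) ∎
    where
    open ≡-Reasoning
    step : VertexType → ℕ
    step c = wordSum (φ ∘ (weight a c +_)) c m

    byType : ∀ r t b →
      (∑³ m λ hs ts bs → validTerm φ a (extend l t b (mv (r ∷ hs) ts bs))) ≡ maybe step 0 (vertexType l t r b)
    byType r t b = trans (∑³-cong m λ hs ts bs → validTerm-extend φ a l t b (mv (r ∷ hs) ts bs)) rest
      where
      rest : (∑³ m λ hs ts bs → maybe (λ c → validTerm (φ ∘ (weight a c +_)) c (mv (r ∷ hs) ts bs)) 0 (vertexType l t r b))
        ≡ maybe step 0 (vertexType l t r b)
      rest with vertexType l t r b
      ... | nothing = ∑³-zero m
      -- The induction hypothesis holds for every left sign, so `r` drops out.
      ... | just c  = validSum≡wordSum m (φ ∘ (weight a c +_)) c r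

    -- For either left sign exactly three of the eight triples have a type, one of each kind, which
    -- makes the sum independent of `l`.
    collect : ∀ l → (∑± λ r → ∑± λ t → ∑± λ b → maybe step 0 (vertexType l t r b)) ≡ step T + step R + step B
    collect ⊕ = solve 3 (λ x y z → z :+ (x :+ con 0) :+ (y :+ con 0 :+ con 0) := x :+ y :+ z) refl (step T) (step R) (step B)
    collect ⊖ = solve 3 (λ x y z → y :+ (x :+ (z :+ con 0)) := x :+ y :+ z) refl (step T) (step R) (step B)

  -- Degree counts and their recurrence.

  δ : ℕ → ℕ → ℕ
  δ d n = indicator (does (n ≟ⁿ d))

  -- The factor 2 is the free sign of the leftmost horizontal crease; the letter `R` stands for the
  -- left boundary.
  v-wordSum : ∀ m d → v (suc m) d ≡ 2 * wordSum (δ d) R m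
  v-wordSum m d = begin
    v (suc m) d
      ≡⟨ length-filter-∑ _ (assignments m) ⟩
    ∑ (assignments m) term
      ≡⟨ ∑-cartesianProductWith _ (signVectors (suc m)) (cartesianProduct (signVectors m) (signVectors m)) term ⟩
    (∑ (signVectors (suc m)) λ hs → ∑ (cartesianProduct (signVectors m) (signVectors m)) λ (ts , bs) → term (mv hs ts bs))
      ≡⟨ (∑-cong (signVectors (suc m)) λ hs → ∑-cartesianProductWith _,_ (signVectors m) (signVectors m) _) ⟩
    (∑ (signVectors (suc m)) λ hs → ∑ (signVectors m) λ ts → ∑ (signVectors m) λ bs → term (mv hs ts bs))
      ≡⟨ ∑-signVectors-suc m _ ⟩
    (∑± λ l → ∑³ m λ hs ts bs → term (mv (l ∷ hs) ts bs))
      ≡⟨ (∑±-cong λ l → trans (∑³-cong m λ hs ts bs → term-valid (mv (l ∷ hs) ts bs)) (validSum≡wordSum m (δ d) R l)) ⟩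
    (∑± λ l → wordSum (δ d) R m)
      ≡⟨ cong (wordSum (δ d) R m +_) (sym (+-identityʳ _)) ⟩
    2 * wordSum (δ d) R m ∎
    where
    open ≡-Reasoning
    term : MV m → ℕ
    term μ = indicator (valid μ ∧ does (flippableFaces μ ≟ⁿ d))

    guard : ∀ p {q r} → (p ≡ true → q ≡ r) → indicator (p ∧ q) ≡ (if p then indicator r else 0)
    guard false q≡r = refl
    guard true  q≡r = cong indicator (q≡r refl)

    term-valid : ∀ μ → term μ ≡ validTerm (δ d) R μ
    term-valid μ = guard (valid μ) λ valid-μ → cong (λ n → does (n ≟ⁿ d)) (flippableFaces-degree μ valid-μ)

  -- Exchanging the two rows swaps `T` and `B`, fixes `R` and preserves all weights.
  wordSum-T≡B : ∀ m φ → wordSum φ T m ≡ wordSum φ B m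
  wordSum-T≡B zero    φ = refl
  wordSum-T≡B (suc m) φ rewrite wordSum-T≡B m φ | wordSum-T≡B m (φ ∘ suc) =
    solve 3 (λ x y z → x :+ y :+ z := z :+ y :+ x) refl
      (wordSum φ B m) (wordSum (φ ∘ suc) R m) (wordSum (φ ∘ suc) B m)

  -- The characteristic equation of the transfer matrix with T and B identified,
  -- (y²  2y ; y  1+y), where precomposition of φ with suc plays the role of y.
  wordSum-recurrence : ∀ m φ →
    wordSum φ R (2 + m) + wordSum (φ ∘ (3 +_)) R m ≡
    wordSum φ R (1 + m) + wordSum (φ ∘ (1 +_)) R (1 + m) + wordSum (φ ∘ (2 +_)) R (1 + m) + wordSum (φ ∘ (2 +_)) R m
  wordSum-recurrence m φ
    rewrite wordSum-T≡B m (φ ∘ (1 +_)) | wordSum-T≡B m (φ ∘ (2 +_)) | wordSum-T≡B m (φ ∘ (3 +_)) =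
    -- The trace is `1 + y + y²` and the determinant `y³ − y²`. All sums unfold to length `m`, where
    -- the equation is a linear identity in six of them; the `y³` term sits on the left to avoid
    -- subtraction.
    solve 6 (λ r₂ r₃ r₄ t₁ t₂ t₃ →
        (t₁ :+ r₂ :+ t₂) :+ (t₃ :+ r₄ :+ t₃) :+ (t₂ :+ r₂ :+ t₁) :+ r₃
        := (t₁ :+ r₂ :+ t₁) :+ (t₂ :+ r₃ :+ t₂) :+ (t₃ :+ r₄ :+ t₃) :+ r₂)
      refl (wordSum (φ ∘ (2 +_)) R m) (wordSum (φ ∘ (3 +_)) R m) (wordSum (φ ∘ (4 +_)) R m)
      (wordSum (φ ∘ (1 +_)) B m) (wordSum (φ ∘ (2 +_)) B m) (wordSum (φ ∘ (3 +_)) B m)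

  v-recurrence : ∀ m e →
    v (3 + m) (3 + e) + v (1 + m) e ≡ v (2 + m) (3 + e) + v (2 + m) (2 + e) + v (2 + m) (1 + e) + v (1 + m) (1 + e)
  v-recurrence m e = begin
    v (3 + m) (3 + e) + v (1 + m) e
      ≡⟨ cong₂ _+_ (v-wordSum (2 + m) (3 + e)) (v-wordSum m e) ⟩
    2 * w (2 + m) (3 + e) + 2 * w m e
      ≡⟨ *-distribˡ-+ 2 (w (2 + m) (3 + e)) (w m e) ⟨
    2 * (w (2 + m) (3 + e) + w m e)
      -- Because the target is `3 + e`, composing `δ` with a shift by at most 3 computes to `δ` at
      -- the lowered target.
      ≡⟨ cong (2 *_) (wordSum-recurrence m (δ (3 + e))) ⟩
    2 * (w (1 + m) (3 + e) + w (1 + m) (2 + e) + w (1 + m) (1 + e) + w m (1 + e))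
      ≡⟨ solve 4 (λ x y z u → con 2 :* (x :+ y :+ z :+ u) := con 2 :* x :+ con 2 :* y :+ con 2 :* z :+ con 2 :* u) refl
           (w (1 + m) (3 + e)) (w (1 + m) (2 + e)) (w (1 + m) (1 + e)) (w m (1 + e)) ⟩
    2 * w (1 + m) (3 + e) + 2 * w (1 + m) (2 + e) + 2 * w (1 + m) (1 + e) + 2 * w m (1 + e)
      ≡⟨ cong₂ _+_ (cong₂ _+_ (cong₂ _+_ (v-wordSum (1 + m) (3 + e)) (v-wordSum (1 + m) (2 + e)))
           (v-wordSum (1 + m) (1 + e))) (v-wordSum m (1 + e)) ⟨
    v (2 + m) (3 + e) + v (2 + m) (2 + e) + v (2 + m) (1 + e) + v (1 + m) (1 + e) ∎
    where
    open ≡-Reasoning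
    w : ℕ → ℕ → ℕ
    w m d = wordSum (δ d) R m

  -- Degrees 0, 1 and 2.

  wordSum-zero : ∀ m a → wordSum (λ _ → 0) a m ≡ 0
  wordSum-zero zero    a = refl
  wordSum-zero (suc m) a rewrite wordSum-zero m T | wordSum-zero m R | wordSum-zero m B = refl

  -- The word ends at the boundary `R`, so the run of `T` is left at some point, which costs 1. Past
  -- a positive weight `δ 0` becomes the zero function.
  wordSum-δ₀-T : ∀ m → wordSum (δ 0) T m ≡ 0
  wordSum-δ₀-T zero    = refl
  wordSum-δ₀-T (suc m) rewrite wordSum-δ₀-T m | wordSum-zero m R | wordSum-zero m B = refl

  wordSum-δ₀-R : ∀ m → wordSum (δ 0) R m ≡ 0
  wordSum-δ₀-R zero    = refl
  wordSum-δ₀-R (suc m) rewrite wordSum-zero m T | wordSum-zero m R | wordSum-zero m B = refl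

  -- Only the word `T…T` contributes, paying 1 at the right end. Leaving `T` earlier already costs 1
  -- and would require a remainder of degree 0.
  wordSum-δ₁-T : ∀ m → wordSum (δ 1) T m ≡ 1
  wordSum-δ₁-T zero    = refl
  wordSum-δ₁-T (suc m)
    rewrite wordSum-δ₁-T m | wordSum-δ₀-R m | sym (wordSum-T≡B m (δ 0)) | wordSum-δ₀-T m = refl

  wordSum-δ₁-R : ∀ m → wordSum (δ 1) R m ≡ 0
  wordSum-δ₁-R zero    = refl
  wordSum-δ₁-R (suc m)
    rewrite sym (wordSum-T≡B m (δ 0)) | wordSum-δ₀-T m | wordSum-zero m R = refl

  -- The contributing words are `T…T` and `B…B`. The length has to be positive: the empty word gives
  -- 1 instead, so row 2 is constant only from `n = 2`.
  wordSum-δ₂-R : ∀ m → wordSum (δ 2) R (suc m) ≡ 2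
  wordSum-δ₂-R m
    rewrite sym (wordSum-T≡B m (δ 1)) | wordSum-δ₁-T m | wordSum-δ₀-R m = refl

  v-zero : ∀ m → v (1 + m) 0 ≡ 0
  v-zero m = trans (v-wordSum m 0) (cong (2 *_) (wordSum-δ₀-R m))

  v-one : ∀ m → v (1 + m) 1 ≡ 0
  v-one m = trans (v-wordSum m 1) (cong (2 *_) (wordSum-δ₁-R m))

  v-two : ∀ m → v (2 + m) 2 ≡ 4
  v-two m = trans (v-wordSum (1 + m) 2) (cong (2 *_) (wordSum-δ₂-R m))

module Interpolation where

  import Data.Integer as ℤ
  import Data.Integer.Properties as ℤ
  open import Data.Integer using (+_)
  open import Data.List using ([]; _∷_)
  import Data.Nat as ℕ using (_+_)
  import Data.Nat.Properties as ℕ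
  open import Data.Rational using (ℚ; 0ℚ; 1ℚ; _+_; _*_; _-_; -_; _/_; fromℚᵘ)
  open import Data.Rational.Properties
  import Data.Rational.Unnormalised as ℚᵘ
  import Data.Rational.Unnormalised.Properties as ℚᵘ
  open import Data.Rational.Solver using (module +-*-Solver)

  open +-*-Solver using (solve; _:+_; _:*_; _:-_; :-_; _:=_; con)

  -- Natural numbers and factorials in the rationals.

  fromℚᵘ-homo-+ : ∀ p q → fromℚᵘ (p ℚᵘ.+ q) ≡ fromℚᵘ p + fromℚᵘ q
  fromℚᵘ-homo-+ p q = toℚᵘ-injective
    (ℚᵘ.≃-trans (toℚᵘ-fromℚᵘ (p ℚᵘ.+ q))
      (ℚᵘ.≃-sym (ℚᵘ.≃-trans (toℚᵘ-homo-+ (fromℚᵘ p) (fromℚᵘ q)) (ℚᵘ.+-cong (toℚᵘ-fromℚᵘ p) (toℚᵘ-fromℚᵘ q)))))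

  fromℚᵘ-homo-* : ∀ p q → fromℚᵘ (p ℚᵘ.* q) ≡ fromℚᵘ p * fromℚᵘ q
  fromℚᵘ-homo-* p q = toℚᵘ-injective
    (ℚᵘ.≃-trans (toℚᵘ-fromℚᵘ (p ℚᵘ.* q))
      (ℚᵘ.≃-sym (ℚᵘ.≃-trans (toℚᵘ-homo-* (fromℚᵘ p) (fromℚᵘ q)) (ℚᵘ.*-cong (toℚᵘ-fromℚᵘ p) (toℚᵘ-fromℚᵘ q)))))

  -- Normalisation by the gcd does not compute on variables, so the identity is checked on
  -- unnormalised fractions and transported.
  fromℕ-+ : ∀ m n → fromℕ (m ℕ.+ n) ≡ fromℕ m + fromℕ n
  fromℕ-+ m n = trans
    (fromℚᵘ-cong {ℚᵘ.mkℚᵘ (+ (m ℕ.+ n)) 0} {ℚᵘ.mkℚᵘ (+ m) 0 ℚᵘ.+ ℚᵘ.mkℚᵘ (+ n) 0}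
      (ℚᵘ.*≡* (cong (ℤ._* (+ 1)) (sym (cong₂ ℤ._+_ (ℤ.*-identityʳ (+ m)) (ℤ.*-identityʳ (+ n)))))))
    (fromℚᵘ-homo-+ (ℚᵘ.mkℚᵘ (+ m) 0) (ℚᵘ.mkℚᵘ (+ n) 0))

  fromℕ-suc : ∀ n → fromℕ (suc n) ≡ 1ℚ + fromℕ n
  fromℕ-suc n = fromℕ-+ 1 n

  reciprocal : ℕ → ℚ
  reciprocal n = + 1 / suc n

  reciprocal-inverseˡ : ∀ n → reciprocal n * fromℕ (suc n) ≡ 1ℚ
  reciprocal-inverseˡ n = trans
    (sym (fromℚᵘ-homo-* (ℚᵘ.mkℚᵘ (+ 1) n) (ℚᵘ.mkℚᵘ (+ suc n) 0)))
    (fromℚᵘ-cong {ℚᵘ.mkℚᵘ (+ 1) n ℚᵘ.* ℚᵘ.mkℚᵘ (+ suc n) 0} {ℚᵘ.1ℚᵘ}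
      (ℚᵘ.*≡* (cong (λ m → + suc m)
        (trans (ℕ.*-identityʳ (n ℕ.+ 0)) (cong (ℕ._+ 0) (sym (ℕ.*-identityʳ n)))))))

  factorial reciprocalFactorial : ℕ → ℚ
  factorial zero    = 1ℚ
  factorial (suc k) = fromℕ (suc k) * factorial k
  reciprocalFactorial zero    = 1ℚ
  reciprocalFactorial (suc k) = reciprocal k * reciprocalFactorial k

  reciprocalFactorial-inverseˡ : ∀ k → reciprocalFactorial k * factorial k ≡ 1ℚ
  reciprocalFactorial-inverseˡ zero    = refl
  reciprocalFactorial-inverseˡ (suc k) = begin
    (r * rs) * (s * ss)  ≡⟨ solve 4 (λ r rs s ss → (r :* rs) :* (s :* ss) := (r :* s) :* (rs :* ss)) refl r rs s ss ⟩
    (r * s) * (rs * ss)  ≡⟨ cong₂ _*_ (reciprocal-inverseˡ k) (reciprocalFactorial-inverseˡ k) ⟩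
    1ℚ                   ∎
    where
    open ≡-Reasoning
    r = reciprocal k
    s = fromℕ (suc k)
    rs = reciprocalFactorial k
    ss = factorial k

  -- Finite differences

  Δ : (ℕ → ℚ) → ℕ → ℚ
  Δ f n = f (suc n) - f n

  -- Recursion replaces `f` by its difference, so proofs go by induction on `k` with `f` arbitrary.
  EventualΔ : ℕ → ℕ → ℚ → (ℕ → ℚ) → Set
  EventualΔ t zero    c f = ∀ n → t ≤ n → f n ≡ c
  EventualΔ t (suc k) c f = EventualΔ t k c (Δ f)

  module _ {t : ℕ} where

    -- A difference at `n` looks only at `n` and `suc n`, so agreement from `t` on passes to `Δ`
    -- with the same `t`. This takes the place of function extensionality.
    EventualΔ-resp : ∀ k {c f g} → (∀ n → t ≤ n → f n ≡ g n) → EventualΔ t k c f → EventualΔ t k c g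
    EventualΔ-resp zero    f≗g p n t≤n = trans (sym (f≗g n t≤n)) (p n t≤n)
    EventualΔ-resp (suc k) f≗g p =
      EventualΔ-resp k (λ n t≤n → cong₂ _-_ (f≗g (suc n) (ℕ.m≤n⇒m≤1+n t≤n)) (f≗g n t≤n)) p

    EventualΔ-+ : ∀ k {c d f g} → EventualΔ t k c f → EventualΔ t k d g → EventualΔ t k (c + d) (λ n → f n + g n)
    EventualΔ-+ zero    p q n t≤n = cong₂ _+_ (p n t≤n) (q n t≤n)
    EventualΔ-+ (suc k) {f = f} {g = g} p q = EventualΔ-resp k
      (λ n _ → solve 4 (λ a b c d → (a :- b) :+ (c :- d) := (a :+ c) :- (b :+ d)) refl (f (suc n)) (f n) (g (suc n)) (g n))
      (EventualΔ-+ k p q)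

    EventualΔ-* : ∀ k q {c f} → EventualΔ t k c f → EventualΔ t k (q * c) (λ n → q * f n)
    EventualΔ-* zero    q p n t≤n = cong (q *_) (p n t≤n)
    EventualΔ-* (suc k) q {f = f} p = EventualΔ-resp k
      (λ n _ → solve 3 (λ a b c → a :* (b :- c) := a :* b :- a :* c) refl q (f (suc n)) (f n))
      (EventualΔ-* k q p)

    EventualΔ-suc : ∀ k {c f} → EventualΔ t k c f → EventualΔ t (suc k) 0ℚ f
    EventualΔ-suc zero    {c} p n t≤n = trans (cong₂ _-_ (p (suc n) (ℕ.m≤n⇒m≤1+n t≤n)) (p n t≤n)) (+-inverseʳ c)
    EventualΔ-suc (suc k) p = EventualΔ-suc k p

    -- Where differences vanish from `t` on, upward induction from `t` carries the value at `t`
    -- along; that value is the witness.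
    EventualΔ-unsuc : ∀ k {f} → EventualΔ t (suc k) 0ℚ f → ∃[ c ] EventualΔ t k c f
    EventualΔ-unsuc zero    {f} p = f t , λ n t≤n → constant (ℕ.≤⇒≤′ t≤n)
      where
      constant : ∀ {n} → t ≤′ n → f n ≡ f t
      constant ≤′-refl               = refl
      constant (≤′-step {n = n} t≤n) = begin
        f (suc n)         ≡⟨ solve 2 (λ a b → a := (a :- b) :+ b) refl (f (suc n)) (f n) ⟩
        Δ f n + f n       ≡⟨ cong₂ _+_ (p n (ℕ.≤′⇒≤ t≤n)) (constant t≤n) ⟩
        0ℚ + f t          ≡⟨ +-identityˡ (f t) ⟩
        f t               ∎
        where open ≡-Reasoning
    EventualΔ-unsuc (suc k) p = EventualΔ-unsuc k p

  EventualΔ-mono : ∀ {s t} k {c f} → s ≤ t → EventualΔ s k c f → EventualΔ t k c f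
  EventualΔ-mono zero    s≤t p n t≤n = p n (ℕ.≤-trans s≤t t≤n)
  EventualΔ-mono (suc k) s≤t p = EventualΔ-mono k s≤t p

  -- The convention `pred 0 = 0` does no harm: the raised threshold excludes 0, and elsewhere `Δ`
  -- commutes with the shift.
  EventualΔ-pred : ∀ {t} k {c f} → EventualΔ t k c f → EventualΔ (suc t) k c (f ∘ pred)
  EventualΔ-pred zero    p (suc n) (s≤s t≤n) = p n t≤n
  EventualΔ-pred (suc k) p =
    EventualΔ-resp k (λ { (suc n) (s≤s t≤n) → refl }) (EventualΔ-pred k p)

  -- Polynomials

  infixl 6 _⊞_
  infixl 7 _⊡_

  _⊞_ : Polynomial → Polynomial → Polynomial
  []      ⊞ q       = q
  (a ∷ p) ⊞ []      = a ∷ p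
  (a ∷ p) ⊞ (b ∷ q) = a + b ∷ p ⊞ q

  _⊡_ : ℚ → Polynomial → Polynomial
  c ⊡ []      = []
  c ⊡ (a ∷ p) = c * a ∷ c ⊡ p

  coeff-⊞ : ∀ p q i → coeff (p ⊞ q) i ≡ coeff p i + coeff q i
  coeff-⊞ []      q       i       = sym (+-identityˡ (coeff q i))
  coeff-⊞ (a ∷ p) []      i       = sym (+-identityʳ (coeff (a ∷ p) i))
  coeff-⊞ (a ∷ p) (b ∷ q) zero    = refl
  coeff-⊞ (a ∷ p) (b ∷ q) (suc i) = coeff-⊞ p q i

  coeff-⊡ : ∀ c p i → coeff (c ⊡ p) i ≡ c * coeff p i
  coeff-⊡ c []      i       = sym (*-zeroʳ c)
  coeff-⊡ c (a ∷ p) zero    = refl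
  coeff-⊡ c (a ∷ p) (suc i) = coeff-⊡ c p i

  eval-⊞ : ∀ p q x → eval (p ⊞ q) x ≡ eval p x + eval q x
  eval-⊞ []      q       x = sym (+-identityˡ (eval q x))
  eval-⊞ (a ∷ p) []      x = sym (+-identityʳ (eval (a ∷ p) x))
  eval-⊞ (a ∷ p) (b ∷ q) x = trans (cong (λ y → a + b + x * y) (eval-⊞ p q x))
    (solve 5 (λ a b x p q → a :+ b :+ x :* (p :+ q) := (a :+ x :* p) :+ (b :+ x :* q)) refl a b x (eval p x) (eval q x))

  eval-⊡ : ∀ c p x → eval (c ⊡ p) x ≡ c * eval p x
  eval-⊡ c []      x = sym (*-zeroʳ c)
  eval-⊡ c (a ∷ p) x = trans (cong (λ y → c * a + x * y) (eval-⊡ c p x))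
    (solve 4 (λ c a x p → c :* a :+ x :* (c :* p) := c :* (a :+ x :* p)) refl c a x (eval p x))

  -- The falling factorial `x (x − 1) ⋯ (x − k + 1)`; prepending `0ℚ` multiplies by `x`.
  falling : ℕ → Polynomial
  falling zero    = 1ℚ ∷ []
  falling (suc k) = (0ℚ ∷ falling k) ⊞ (- fromℕ k) ⊡ falling k

  coeff-falling-> : ∀ k i → k < i → coeff (falling k) i ≡ 0ℚ
  coeff-falling-> zero    (suc i) _         = refl
  coeff-falling-> (suc k) (suc i) (s≤s k<i) = begin
    coeff (falling (suc k)) (suc i)                           ≡⟨ coeff-⊞ (0ℚ ∷ falling k) ((- fromℕ k) ⊡ falling k) (suc i) ⟩
    coeff (falling k) i + coeff ((- fromℕ k) ⊡ falling k) (suc i)  ≡⟨ cong₂ _+_ (coeff-falling-> k i k<i) (coeff-⊡ (- fromℕ k) (falling k) (suc i)) ⟩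
    0ℚ + - fromℕ k * coeff (falling k) (suc i)                ≡⟨ cong (λ y → 0ℚ + - fromℕ k * y) (coeff-falling-> k (suc i) (ℕ.m≤n⇒m≤1+n k<i)) ⟩
    0ℚ + - fromℕ k * 0ℚ                                       ≡⟨ trans (+-identityˡ _) (*-zeroʳ (- fromℕ k)) ⟩
    0ℚ                                                        ∎
    where open ≡-Reasoning

  coeff-falling-≡ : ∀ k → coeff (falling k) k ≡ 1ℚ
  coeff-falling-≡ zero    = refl
  coeff-falling-≡ (suc k) = begin
    coeff (falling (suc k)) (suc k)                           ≡⟨ coeff-⊞ (0ℚ ∷ falling k) ((- fromℕ k) ⊡ falling k) (suc k) ⟩
    coeff (falling k) k + coeff ((- fromℕ k) ⊡ falling k) (suc k)  ≡⟨ cong₂ _+_ (coeff-falling-≡ k) (coeff-⊡ (- fromℕ k) (falling k) (suc k)) ⟩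
    1ℚ + - fromℕ k * coeff (falling k) (suc k)                ≡⟨ cong (λ y → 1ℚ + - fromℕ k * y) (coeff-falling-> k (suc k) ℕ.≤-refl) ⟩
    1ℚ + - fromℕ k * 0ℚ                                       ≡⟨ cong (λ y → 1ℚ + y) (*-zeroʳ (- fromℕ k)) ⟩
    1ℚ                                                        ∎
    where open ≡-Reasoning

  eval-falling-suc : ∀ k x → eval (falling (suc k)) x ≡ (x - fromℕ k) * eval (falling k) x
  eval-falling-suc k x = begin
    eval (falling (suc k)) x                         ≡⟨ eval-⊞ (0ℚ ∷ falling k) ((- fromℕ k) ⊡ falling k) x ⟩
    0ℚ + x * e + eval ((- fromℕ k) ⊡ falling k) x    ≡⟨ cong₂ _+_ (+-identityˡ (x * e)) (eval-⊡ (- fromℕ k) (falling k) x) ⟩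
    x * e + - fromℕ k * e                            ≡⟨ *-distribʳ-+ e x (- fromℕ k) ⟨
    (x - fromℕ k) * e                                ∎
    where
    open ≡-Reasoning
    e = eval (falling k) x

  fallingAt : ℕ → ℕ → ℚ
  fallingAt k n = eval (falling k) (fromℕ n)

  -- The discrete power rule, by induction with a product rule for the new factor `x − k`.
  Δ-fallingAt : ∀ k n → Δ (fallingAt (suc k)) n ≡ fromℕ (suc k) * fallingAt k n
  Δ-fallingAt zero n = begin
    fallingAt 1 (suc n) - fallingAt 1 n
      ≡⟨ cong₂ _-_ (eval-falling-suc 0 (fromℕ (suc n))) (eval-falling-suc 0 (fromℕ n)) ⟩
    (fromℕ (suc n) - 0ℚ) * fallingAt 0 (suc n) - (fromℕ n - 0ℚ) * fallingAt 0 n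
      ≡⟨ cong₂ (λ y z → (y - 0ℚ) * z - (fromℕ n - 0ℚ) * fallingAt 0 n) (fromℕ-suc n) (trans (const (fromℕ (suc n))) (sym (const (fromℕ n)))) ⟩
    (1ℚ + fromℕ n - 0ℚ) * fallingAt 0 n - (fromℕ n - 0ℚ) * fallingAt 0 n
      ≡⟨ solve 2 (λ x y → (con 1ℚ :+ x :- con 0ℚ) :* y :- (x :- con 0ℚ) :* y := con 1ℚ :* y) refl (fromℕ n) (fallingAt 0 n) ⟩
    fromℕ 1 * fallingAt 0 n ∎
    where
    open ≡-Reasoning
    const : ∀ x → eval (falling 0) x ≡ 1ℚ
    const x = cong (λ y → 1ℚ + y) (*-zeroʳ x)
  Δ-fallingAt (suc k) n = begin
    fallingAt (2 ℕ.+ k) (suc n) - fallingAt (2 ℕ.+ k) n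
      ≡⟨ cong₂ _-_ (eval-falling-suc (suc k) (fromℕ (suc n))) (eval-falling-suc (suc k) (fromℕ n)) ⟩
    (fromℕ (suc n) - K) * fallingAt (suc k) (suc n) - (x - K) * F
      -- Subtracting and adding `F` exposes the difference to which the induction hypothesis
      -- applies.
      ≡⟨ cong₂ (λ y z → (y - K) * z - (x - K) * F) (fromℕ-suc n)
           (solve 2 (λ a b → a := (a :- b) :+ b) refl (fallingAt (suc k) (suc n)) F) ⟩
    (1ℚ + x - K) * (Δ (fallingAt (suc k)) n + F) - (x - K) * F
      ≡⟨ cong (λ y → (1ℚ + x - K) * (y + F) - (x - K) * F) (Δ-fallingAt k n) ⟩
    (1ℚ + x - K) * (K * G + F) - (x - K) * F
      ≡⟨ cong (λ y → (1ℚ + x - y) * (K * G + F) - (x - K) * F) (fromℕ-suc k) ⟩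
    (1ℚ + x - (1ℚ + fromℕ k)) * (K * G + F) - (x - K) * F
      ≡⟨ solve 5 (λ x k K F G → (con 1ℚ :+ x :- (con 1ℚ :+ k)) :* (K :* G :+ F) :- (x :- K) :* F
             := K :* ((x :- k) :* G) :+ (K :- k) :* F) refl x (fromℕ k) K F G ⟩
    K * ((x - fromℕ k) * G) + (K - fromℕ k) * F
      -- The product `(x − k) G` is `F` again, and `K − k` is 1.
      ≡⟨ cong₂ (λ y z → K * y + z * F) (sym (eval-falling-suc k x))
          (trans (cong (_- fromℕ k) (fromℕ-suc k)) (solve 1 (λ k → con 1ℚ :+ k :- k := con 1ℚ) refl (fromℕ k))) ⟩
    K * F + 1ℚ * F
      ≡⟨ solve 2 (λ K F → K :* F :+ con 1ℚ :* F := (con 1ℚ :+ K) :* F) refl K F ⟩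
    (1ℚ + K) * F
      ≡⟨ cong (_* F) (fromℕ-suc (suc k)) ⟨
    fromℕ (2 ℕ.+ k) * F ∎
    where
    open ≡-Reasoning
    x = fromℕ n
    K = fromℕ (suc k)
    F = fallingAt (suc k) n
    G = fallingAt k n

  -- Newton interpolation.

  EventualΔ-fallingAt : ∀ t k → EventualΔ t k (factorial k) (fallingAt k)
  EventualΔ-fallingAt t zero    n _ = cong (λ y → 1ℚ + y) (*-zeroʳ (fromℕ n))
  EventualΔ-fallingAt t (suc k) =
    EventualΔ-resp k (λ n _ → sym (Δ-fallingAt k n)) (EventualΔ-* k (fromℕ (suc k)) (EventualΔ-fallingAt t k))

  -- Subtracting `c / k!` times the falling factorial makes the `k`-th difference vanish; the
  -- preceding difference is then constant and the remainder is handled by induction.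
  interpolate : ∀ t k c f → EventualΔ t k c f →
    ∃[ p ] (coeff p k * factorial k ≡ c × (∀ i → k < i → coeff p i ≡ 0ℚ) × (∀ n → t ≤ n → f n ≡ eval p (fromℕ n)))
  interpolate t zero c f f≡c =
    c ∷ [] , *-identityʳ c , (λ { (suc i) _ → refl }) ,
    λ n t≤n → trans (f≡c n t≤n) (sym (trans (cong (λ y → c + y) (*-zeroʳ (fromℕ n))) (+-identityʳ c)))
  interpolate t (suc k) c f Δf =
    -- The constant `c′` affects only coefficients up to index `k`, so its existence suffices.
    let c′ , Δg          = EventualΔ-unsuc k Δ⁺g
        p , _ , p> , g≡p = interpolate t k c′ g Δg
    in q ⊡ falling (suc k) ⊞ p , leading p p> , higher p p> , values p g≡p
    where
    open ≡-Reasoning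
    q = c * reciprocalFactorial (suc k)

    q*factorial : q * factorial (suc k) ≡ c
    q*factorial = begin
      q * factorial (suc k)                                      ≡⟨ *-assoc c (reciprocalFactorial (suc k)) (factorial (suc k)) ⟩
      c * (reciprocalFactorial (suc k) * factorial (suc k))      ≡⟨ cong (c *_) (reciprocalFactorial-inverseˡ (suc k)) ⟩
      c * 1ℚ                                                     ≡⟨ *-identityʳ c ⟩
      c                                                          ∎

    g : ℕ → ℚ
    g n = f n + - q * fallingAt (suc k) n

    Δ⁺g : EventualΔ t (suc k) 0ℚ g
    Δ⁺g = subst (λ z → EventualΔ t (suc k) z g)
      (trans (cong (λ y → c + y) (trans (sym (neg-distribˡ-* q (factorial (suc k)))) (cong -_ q*factorial))) (+-inverseʳ c))
      (EventualΔ-+ (suc k) {f = f} {g = λ n → - q * fallingAt (suc k) n} Δf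
        (EventualΔ-* (suc k) (- q) {f = fallingAt (suc k)} (EventualΔ-fallingAt t (suc k))))

    module _ (p : Polynomial) where

      coeff-sum : ∀ i → coeff (q ⊡ falling (suc k) ⊞ p) i ≡ q * coeff (falling (suc k)) i + coeff p i
      coeff-sum i = trans (coeff-⊞ (q ⊡ falling (suc k)) p i) (cong (_+ coeff p i) (coeff-⊡ q (falling (suc k)) i))

      leading : (∀ i → k < i → coeff p i ≡ 0ℚ) → coeff (q ⊡ falling (suc k) ⊞ p) (suc k) * factorial (suc k) ≡ c
      leading p> = trans (cong (_* factorial (suc k)) (begin
        coeff (q ⊡ falling (suc k) ⊞ p) (suc k)                 ≡⟨ coeff-sum (suc k) ⟩
        q * coeff (falling (suc k)) (suc k) + coeff p (suc k)   ≡⟨ cong₂ (λ y z → q * y + z) (coeff-falling-≡ (suc k)) (p> (suc k) ℕ.≤-refl) ⟩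
        q * 1ℚ + 0ℚ                                             ≡⟨ trans (+-identityʳ _) (*-identityʳ q) ⟩
        q                                                       ∎)) q*factorial

      higher : (∀ i → k < i → coeff p i ≡ 0ℚ) → ∀ i → suc k < i → coeff (q ⊡ falling (suc k) ⊞ p) i ≡ 0ℚ
      higher p> i k<i = begin
        coeff (q ⊡ falling (suc k) ⊞ p) i           ≡⟨ coeff-sum i ⟩
        q * coeff (falling (suc k)) i + coeff p i   ≡⟨ cong₂ (λ y z → q * y + z) (coeff-falling-> (suc k) i k<i) (p> i (ℕ.<-trans (ℕ.n<1+n k) k<i)) ⟩
        q * 0ℚ + 0ℚ                                 ≡⟨ trans (+-identityʳ _) (*-zeroʳ q) ⟩
        0ℚ                                          ∎

      values : (∀ n → t ≤ n → g n ≡ eval p (fromℕ n)) →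
        ∀ n → t ≤ n → f n ≡ eval (q ⊡ falling (suc k) ⊞ p) (fromℕ n)
      values g≡p n t≤n = begin
        f n                                            ≡⟨ solve 3 (λ f q e → f := q :* e :+ (f :+ :- q :* e)) refl (f n) q (fallingAt (suc k) n) ⟩
        q * fallingAt (suc k) n + g n                  ≡⟨ cong₂ _+_ (sym (eval-⊡ q (falling (suc k)) (fromℕ n))) (g≡p n t≤n) ⟩
        eval (q ⊡ falling (suc k)) (fromℕ n) + eval p (fromℕ n)  ≡⟨ eval-⊞ (q ⊡ falling (suc k)) p (fromℕ n) ⟨
        eval (q ⊡ falling (suc k) ⊞ p) (fromℕ n)       ∎

  coeff≢0 : ∀ p k c → c ≢ 0ℚ → coeff p k * factorial k ≡ c → coeff p k ≢ 0ℚ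
  coeff≢0 p k c c≢0 lead p≡0 = c≢0 (trans (sym lead) (trans (cong (_* factorial k) p≡0) (*-zeroˡ (factorial k))))

  -- Induction on the degree for an array with this recurrence.

  threshold : ℕ → ℕ
  threshold d = ⌈ d /2⌉ ℕ.+ 1

  threshold-step : ∀ d → threshold d ≤ threshold (suc d)
  threshold-step d = ℕ.+-monoˡ-≤ 1 (ℕ.⌈n/2⌉-mono (ℕ.n≤1+n d))

  4ℚ : ℚ
  4ℚ = fromℕ 4

  module _ (u : ℕ → ℕ → ℕ)
    (zero-row   : ∀ m → u (1 ℕ.+ m) 0 ≡ 0)
    (one-row    : ∀ m → u (1 ℕ.+ m) 1 ≡ 0)
    (two-row    : ∀ m → u (2 ℕ.+ m) 2 ≡ 4)
    (recurrence : ∀ m e → u (3 ℕ.+ m) (3 ℕ.+ e) ℕ.+ u (1 ℕ.+ m) e ≡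
      u (2 ℕ.+ m) (3 ℕ.+ e) ℕ.+ u (2 ℕ.+ m) (2 ℕ.+ e) ℕ.+ u (2 ℕ.+ m) (1 ℕ.+ e) ℕ.+ u (1 ℕ.+ m) (1 ℕ.+ e))
    where

    rowAt : ℕ → ℕ → ℚ
    rowAt d n = fromℕ (u n d)

    -- The recurrence solved for the difference, with subtraction now available. It reaches back to
    -- `pred n`, which has to be at least 1.
    Δ-rowAt : ∀ e n → 2 ≤ n →
      Δ (rowAt (3 ℕ.+ e)) n ≡
      rowAt (2 ℕ.+ e) n + rowAt (1 ℕ.+ e) n + rowAt (1 ℕ.+ e) (pred n) + - 1ℚ * rowAt e (pred n)
    Δ-rowAt e (suc (suc m)) (s≤s (s≤s _)) = begin
      p - q₁                        ≡⟨ solve 3 (λ p q₁ r → p :- q₁ := (p :+ r) :- q₁ :- r) refl p q₁ r ⟩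
      (p + r) - q₁ - r              ≡⟨ cong (λ y → y - q₁ - r) difference ⟩
      (q₁ + q₂ + q₃ + q₄) - q₁ - r  ≡⟨ solve 5 (λ q₁ q₂ q₃ q₄ r → (q₁ :+ q₂ :+ q₃ :+ q₄) :- q₁ :- r
                                            := q₂ :+ q₃ :+ q₄ :+ con (- 1ℚ) :* r) refl q₁ q₂ q₃ q₄ r ⟩
      q₂ + q₃ + q₄ + - 1ℚ * r       ∎
      where
      open ≡-Reasoning
      p = rowAt (3 ℕ.+ e) (3 ℕ.+ m)
      q₁ = rowAt (3 ℕ.+ e) (2 ℕ.+ m)
      q₂ = rowAt (2 ℕ.+ e) (2 ℕ.+ m)
      q₃ = rowAt (1 ℕ.+ e) (2 ℕ.+ m)
      q₄ = rowAt (1 ℕ.+ e) (1 ℕ.+ m)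
      r = rowAt e (1 ℕ.+ m)

      difference : p + r ≡ q₁ + q₂ + q₃ + q₄
      difference = begin
        p + r                                           ≡⟨ fromℕ-+ (u (3 ℕ.+ m) (3 ℕ.+ e)) (u (1 ℕ.+ m) e) ⟨
        fromℕ (u (3 ℕ.+ m) (3 ℕ.+ e) ℕ.+ u (1 ℕ.+ m) e) ≡⟨ cong fromℕ (recurrence m e) ⟩
        fromℕ (a ℕ.+ b ℕ.+ c ℕ.+ d)                     ≡⟨ fromℕ-+ (a ℕ.+ b ℕ.+ c) d ⟩
        fromℕ (a ℕ.+ b ℕ.+ c) + q₄                      ≡⟨ cong (_+ q₄) (fromℕ-+ (a ℕ.+ b) c) ⟩
        fromℕ (a ℕ.+ b) + q₃ + q₄                       ≡⟨ cong (λ y → y + q₃ + q₄) (fromℕ-+ a b) ⟩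
        q₁ + q₂ + q₃ + q₄                               ∎
        where
        a = u (2 ℕ.+ m) (3 ℕ.+ e)
        b = u (2 ℕ.+ m) (2 ℕ.+ e)
        c = u (2 ℕ.+ m) (1 ℕ.+ e)
        d = u (1 ℕ.+ m) (1 ℕ.+ e)

    -- Three consecutive rows go together because row `3 + e` depends on the three below it. The two
    -- lower ones have vanishing `e`-th difference, so the constant 4 of the top row passes on
    -- unchanged.
    EventualΔ-rowAt : ∀ e →
      EventualΔ (threshold e) e 0ℚ (rowAt e) ×
      EventualΔ (threshold (1 ℕ.+ e)) e 0ℚ (rowAt (1 ℕ.+ e)) ×
      EventualΔ (threshold (2 ℕ.+ e)) e 4ℚ (rowAt (2 ℕ.+ e))
    EventualΔ-rowAt zero =
      (λ { (suc m) _ → cong fromℕ (zero-row m) }) ,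
      (λ { (suc m) _ → cong fromℕ (one-row m) }) ,
      (λ { (suc (suc m)) _ → cong fromℕ (two-row m) ; (suc zero) (s≤s ()) })
    EventualΔ-rowAt (suc e) with p₀ , p₁ , p₂ ← EventualΔ-rowAt e =
      EventualΔ-suc e p₁ , EventualΔ-suc e p₂ ,
      -- The constants add up by computation: `4ℚ + 0ℚ + 0ℚ + - 1ℚ * 0ℚ` is `4ℚ`.
      EventualΔ-resp e (λ n t≤n → sym (Δ-rowAt e n (ℕ.≤-trans (s≤s (ℕ.m≤n+m 1 ⌈ suc e /2⌉)) t≤n)))
        (EventualΔ-+ e (EventualΔ-+ e (EventualΔ-+ e
          (EventualΔ-mono e (threshold-step (2 ℕ.+ e)) p₂)
          (EventualΔ-mono e (ℕ.≤-trans (threshold-step (1 ℕ.+ e)) (threshold-step (2 ℕ.+ e))) p₁))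
          -- The delay by one column raises the threshold by one, and `suc (threshold (1 + e))` is
          -- exactly `threshold (3 + e)`.
          (EventualΔ-pred e p₁))
          (EventualΔ-* e (- 1ℚ) (EventualΔ-mono e (s≤s (threshold-step e)) (EventualΔ-pred e p₀))))

open import Data.Nat using (_+_)
open Counting using (v-zero; v-one; v-two; v-recurrence)
open Interpolation

theorem4p11 : (d : ℕ) → 2 ≤ d → ∃[ p ] (HasDegree p (d ∸ 2) × ((n : ℕ) → ⌈ d /2⌉ + 1 ≤ n → fromℕ (v n d) ≡ eval p (fromℕ n)))
theorem4p11 (suc (suc e)) (s≤s (s≤s _)) =
  let _ , _ , Δv          = EventualΔ-rowAt v v-zero v-one v-two v-recurrence e
      p , lead , p> , v≡p = interpolate (threshold (2 + e)) e 4ℚ (λ n → fromℕ (v n (2 + e))) Δv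
  -- The leading coefficient times `e!` is 4, hence it is nonzero.
  in p , (coeff≢0 p e 4ℚ (λ ()) lead , p>) , v≡p
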